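{- The poset $\tilde{\mathcal{P}}_k$ is universal for every $k\geq 2$, and the poset $\tilde{\mathcal{L}}_k$ is universal for every $k\geq 3$.
   Context: A $k$-poset is an object $(P;\leq,c)$ where $(P;\leq)$ is a partially ordered set and $c\colon P\to\{0,1,\dots,k-1\}$ is a labeling function. A $k$-lattice is a $k$-poset whose underlying poset is a lattice. A homomorphism of $k$-posets is a map that preserves order ($x\leq y$ implies $h(x)\leq h(y)$) and labels. $\mathcal{P}_k$ and $\mathcal{L}_k$ denote the classes of all finite $k$-posets and all finite $k$-lattices, respectively. The homomorphism quasiorder is defined by $(P,c)\leq(P',c')$ if and only if there is a homomorphism of $(P,c)$ to $(P',c')$; $\equiv$ is the induced equivalence relation; $\tilde{\mathcal{P}}_k=\mathcal{P}_k/{\equiv}$ and $\tilde{\mathcal{L}}_k=\mathcal{L}_k/{\equiv}$ carry the partial order induced by $\leq$. A countable poset is universal if every countable poset can be embedded into it (an embedding is a map $f$ with $x\leq y\iff f(x)\leq f(y)$). -}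

module Defs where

open import Axiom.ExcludedMiddle using (ExcludedMiddle)
open import Data.Fin.Base using (Fin)
open import Data.Nat.Base using (ℕ)
open import Data.Product.Base using (Σ; ∃; ∃₂; _×_; _,_; proj₁)
open import Function.Bundles using (Func; Injection; Inverse)
open import Level using (Level; 0ℓ; _⊔_; suc; Setω)
open import Relation.Binary.Bundles using (Poset)
open import Relation.Binary.Definitions using (Reflexive; Transitive)
import Relation.Binary.Construct.Interior.Symmetric as SymInterior
open import Relation.Binary.Lattice.Structures using (IsLattice)
open import Relation.Binary.Morphism.Bundles using (PosetHomomorphism)
import Relation.Binary.Morphism.Construct.Composition as Composition
import Relation.Binary.Morphism.Construct.Identity as Identity
open import Relation.Binary.Morphism.Structures using (IsOrderMonomorphism)
open import Relation.Binary.PropositionalEquality as ≡ using (_≡_)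

private
  variable
    a ℓ₁ ℓ₂ b ℓ₃ ℓ₄ : Level

-- Classical logic, the ambient logic of the theorem.  Some such assumption is
-- unavoidable: the order of a finite poset need not be decidable here, so a
-- congruent injection of 𝒫̃ 2 into ℕ would already decide every proposition φ
-- (compare the poset {x , y} labelled 0 , 1, in which x ≤ y holds iff φ does,
-- with the chain x ≤ y carrying the same labels).
Classical : Setω
Classical = ∀ {ℓ} → ExcludedMiddle ℓ

-- "Countable" means finite or countably infinite.
Countable : Poset a ℓ₁ ℓ₂ → Set (a ⊔ ℓ₁)
Countable P = Injection (Poset.Eq.setoid P) (≡.setoid ℕ)

Embeds : Poset a ℓ₁ ℓ₂ → Poset b ℓ₃ ℓ₄ → Set (a ⊔ ℓ₁ ⊔ ℓ₂ ⊔ b ⊔ ℓ₃ ⊔ ℓ₄)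
Embeds P Q = ∃ (IsOrderMonomorphism P._≈_ Q._≈_ P._≤_ Q._≤_)
  where
  module P = Poset P
  module Q = Poset Q

-- The levels a, ℓ₁, ℓ₂ are those of the posets to be embedded.
Universal : ∀ a ℓ₁ ℓ₂ → Poset b ℓ₃ ℓ₄ →
            Set (suc (a ⊔ ℓ₁ ⊔ ℓ₂) ⊔ b ⊔ ℓ₃ ⊔ ℓ₄)
Universal a ℓ₁ ℓ₂ U =
  Countable U × ((Q : Poset a ℓ₁ ℓ₂) → Countable Q → Embeds Q U)

Finite : Poset a ℓ₁ ℓ₂ → Set (a ⊔ ℓ₁)
Finite P = ∃ λ n → Inverse (Poset.Eq.setoid P) (≡.setoid (Fin n))

record FiniteKPoset (k : ℕ) : Set (suc 0ℓ) where
  field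
    poset    : Poset 0ℓ 0ℓ 0ℓ
    finite   : Finite poset
    labeling : Func (Poset.Eq.setoid poset) (≡.setoid (Fin k))

  open Poset poset public using (Carrier; _≈_; _≤_)

  label : Carrier → Fin k
  label = Func.to labeling

record Hom {k} (P Q : FiniteKPoset k) : Set where
  private
    module P = FiniteKPoset P
    module Q = FiniteKPoset Q
  field
    homomorphism : PosetHomomorphism P.poset Q.poset

  open PosetHomomorphism homomorphism public using (⟦_⟧)

  field
    preserves-label : ∀ x → Q.label ⟦ x ⟧ ≡ P.label x

Hom-refl : ∀ {k} → Reflexive (Hom {k})
Hom-refl {_} {P} = record
  { homomorphism    = Identity.posetHomomorphism (FiniteKPoset.poset P)
  ; preserves-label = λ _ → ≡.refl
  }

Hom-trans : ∀ {k} → Transitive (Hom {k})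
Hom-trans f g = record
  { homomorphism    = Composition.posetHomomorphism F.homomorphism G.homomorphism
  ; preserves-label = λ x → ≡.trans (G.preserves-label F.⟦ x ⟧) (F.preserves-label x)
  }
  where
  module F = Hom f
  module G = Hom g

-- The quotient by ≡ is formed by taking mutual existence of homomorphisms as
-- the underlying equality of the poset.
𝒫̃ : ℕ → Poset (suc 0ℓ) 0ℓ 0ℓ
𝒫̃ k = SymInterior.poset {R = Hom {k}} Hom-refl Hom-trans

FiniteKLattice : ℕ → Set (suc 0ℓ)
FiniteKLattice k =
  Σ (FiniteKPoset k) λ P → let open FiniteKPoset P in
    ∃₂ λ (_∨_ _∧_ : Carrier → Carrier → Carrier) → IsLattice _≈_ _≤_ _∨_ _∧_

-- Homomorphisms of k-lattices are those of the underlying k-posets: they need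
-- not preserve joins and meets.
LatticeHom : ∀ {k} → FiniteKLattice k → FiniteKLattice k → Set
LatticeHom L M = Hom (proj₁ L) (proj₁ M)

ℒ̃ : ℕ → Poset (suc 0ℓ) 0ℓ 0ℓ
ℒ̃ k = SymInterior.poset {R = LatticeHom {k}} Hom-refl Hom-trans

{-# OPTIONS --safe #-}

-- Let ≼ be a preorder on ℕ, put S j = {i ≤ j ∣ j ≼ i} and N j = ∏_{i ∈ S j} s i
-- for pairwise coprime s i.  Then N i ∣ N j implies j ≼ i, and conversely if
-- moreover i ≤ j.  The disjoint union G m of the directed cycles of length N j,
-- over all j ≤ m with j ≼ m, maps homomorphically to G n iff m ≼ n: a cycle of
-- length a maps to one of length b iff b ∣ a, and for j ≼ m ≼ n the cycle of
-- length N j is itself a component of G n if j ≤ n, and otherwise maps to the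
-- cycle of length N n.
--
-- A finite set with a self-map is encoded by a labelled poset in which every
-- vertex becomes two three-element chains, labelled 0 < 1 < 0 and 1 < 0 < 1,
-- each chain being linked to its successor by "the bottom of the next chain lies
-- below the top of this one".  Homomorphisms have to map chains to chains level
-- by level, hence they are the equivariant maps.  If no vertex is fixed, adding
-- extrema carrying a third label yields a lattice.
module Submission where

open import Defs
open import Axiom.ExcludedMiddle using (ExcludedMiddle)
open import Data.Bool.Base using (Bool; true; false; not; _xor_; if_then_else_)
open import Data.Bool.Properties using (not-injective; xor-comm)
open import Data.Fin.Base as Fin
  using (Fin; zero; suc; toℕ; fromℕ<; inject≤; funToFin; finToFun)
open import Data.Fin.Patterns using (0F; 1F; 2F)
import Data.Fin.Properties as Fin
open import Data.Maybe.Base using (Maybe; just; nothing)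
open import Data.Nat.Base hiding (parity; _⊔_)
open import Data.Nat.Coprimality as Coprime using (Coprime; coprime-divisor)
open import Data.Nat.Divisibility
open import Data.Nat.DivMod
open import Data.Nat.GeneralisedArithmetic using (fold)
open import Data.Nat.Induction using (<-rec)
open import Data.Nat.Properties
open import Data.Product.Base using (Σ; ∃; ∃₂; _×_; _,_; proj₁; proj₂)
open import Data.Product.Function.NonDependent.Propositional using (_×-↔_)
open import Data.Product.Properties.WithK using (,-injectiveʳ)
open import Data.Sum.Base using (_⊎_; inj₁; inj₂; [_,_]′)
open import Data.Sum.Function.Propositional using (_⊎-↔_)
open import Function.Base using (_∘_; flip)
open import Function.Bundles
  using (Func; Injection; Inverse; _↔_; mk↔ₛ′; _⇔_; mk⇔; Equivalence)
open import Function.Construct.Identity using (↔-id)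
open import Function.Construct.Composition using (_↔-∘_)
open import Function.Construct.Symmetry using (↔-sym)
open import Function.Definitions using (Injective)
open import Level using (Level; 0ℓ; _⊔_)
open import Relation.Binary.Bundles using (Poset; Setoid)
import Relation.Binary.Construct.Add.Extrema.NonStrict as Extrema
import Relation.Binary.Construct.Add.Supremum.NonStrict as Supremum
open import Relation.Binary.Construct.Interior.Symmetric using (_,_)
open import Relation.Binary.Core using (Rel)
open import Relation.Binary.Definitions using (Reflexive; Transitive; Decidable; tri<; tri≈; tri>)
open import Relation.Binary.Lattice.Structures using (IsLattice)
open import Relation.Binary.Morphism.Bundles using (PosetHomomorphism)
open import Relation.Binary.PropositionalEquality hiding ([_])
open import Relation.Binary.Structures using (IsPartialOrder)
open import Relation.Nullary using (¬_; Dec; yes; no; does; contradiction)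
open import Relation.Nullary.Construct.Add.Extrema using (_±; ⊥±; ⊤±; [_])

private
  variable
    a b ℓ ℓ₁ ℓ₂ : Level
    A V W : Set
    k m n p q : ℕ

-- Divisibility

-- Sylvester's sequence 2, 3, 7, 43, ..., which is pairwise coprime by construction.
sylvesterProduct sylvester : ℕ → ℕ
sylvesterProduct zero    = 1
sylvesterProduct (suc i) = sylvesterProduct i * sylvester i
sylvester i = suc (sylvesterProduct i)

sylvester∣product : ∀ {i j} → i <′ j → sylvester i ∣ sylvesterProduct j
sylvester∣product {i} <′-base     = n∣m*n (sylvesterProduct i)
sylvester∣product (≤′-step {j} i<j) = ∣-trans (sylvester∣product i<j) (m∣m*n (sylvester j))

-- A common divisor divides `sylvesterProduct j`, which has `sylvester i` as a factor, and also its
-- successor `sylvester j`, hence 1.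
<⇒coprime-sylvester : ∀ {i j} → i < j → Coprime (sylvester i) (sylvester j)
<⇒coprime-sylvester {i} {j} i<j (d∣i , d∣j) = ∣1⇒≡1 (∣m+n∣m⇒∣n
  (subst (_∣_ _) (+-comm 1 (sylvesterProduct j)) d∣j)
  (∣-trans d∣i (sylvester∣product (<⇒<′ i<j))))

coprime-sylvester : ∀ {i j} → i ≢ j → Coprime (sylvester i) (sylvester j)
coprime-sylvester {i} {j} i≢j with <-cmp i j
... | tri< i<j _ _ = <⇒coprime-sylvester i<j
... | tri≈ _ i≡j _ = contradiction i≡j i≢j
... | tri> _ _ j<i = Coprime.sym (<⇒coprime-sylvester j<i)

sylvester∤1 : ∀ i → sylvester i ∤ 1
sylvester∤1 i s∣1 = product≢0 i (suc-injective (∣1⇒≡1 s∣1))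
  where
  product≢0 : ∀ i → sylvesterProduct i ≢ 0
  product≢0 (suc i) eq with m*n≡0⇒m≡0∨n≡0 (sylvesterProduct i) eq
  ... | inj₁ eq′ = product≢0 i eq′

∏ : (ℕ → ℕ) → ℕ → ℕ
∏ f zero    = 1
∏ f (suc n) = ∏ f n * f n

∏-nonZero : ∀ {f} → (∀ i → NonZero (f i)) → ∀ n → NonZero (∏ f n)
∏-nonZero f≢0 zero    = _
∏-nonZero {f} f≢0 (suc n) = m*n≢0 (∏ f n) (f n) {{∏-nonZero f≢0 n}} {{f≢0 n}}

∏-mono-∣ : ∀ {f g} → (∀ {i} → i < m → f i ∣ g i) → m ≤′ n → ∏ f m ∣ ∏ g n
∏-mono-∣ {zero}  f∣g ≤′-refl = ∣-refl
∏-mono-∣ {suc m} f∣g ≤′-refl =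
  *-pres-∣ (∏-mono-∣ (f∣g ∘ m<n⇒m<1+n) (≤′-refl {m})) (f∣g ≤-refl)
∏-mono-∣ {g = g} f∣g (≤′-step {n} m≤n) = ∣-trans (∏-mono-∣ f∣g m≤n) (m∣m*n (g n))

-- Euclid's lemma strips the factors one at a time.
coprime-∏ : ∀ {d f} → (∀ i → Coprime d (f i)) → ∀ n → d ∣ ∏ f n → d ∣ 1
coprime-∏ coprime zero    d∣1 = d∣1
coprime-∏ {d} {f} coprime (suc n) d∣∏ = coprime-∏ coprime n
  (coprime-divisor (coprime n) (subst (d ∣_) (*-comm (∏ f n) (f n)) d∣∏))

-- Disjoint unions of cycles

Equivariant : (V → V) → (W → W) → Set
Equivariant {V} {W} σ τ = Σ (V → W) λ g → ∀ v → g (σ v) ≡ τ (g v)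

fold-equivariant : ∀ {σ : V → V} {τ : W → W} ((g , _) : Equivariant σ τ) →
                   ∀ v k → g (fold v σ k) ≡ fold (g v) τ k
fold-equivariant _ v zero    = refl
fold-equivariant {τ = τ} G@(_ , g-σ) v (suc k) =
  trans (g-σ _) (cong τ (fold-equivariant G v k))

shift : Fin n → Fin n
shift {suc n} r = suc (toℕ r) mod suc n

suc-% : ∀ m n .{{_ : NonZero n}} → suc (m % n) % n ≡ suc m % n
suc-% m n = begin
  suc (m % n) % n             ≡⟨ %-distribˡ-+ 1 (m % n) n ⟩
  (1 % n + m % n % n) % n     ≡⟨ cong (λ x → (1 % n + x) % n) (m%n%n≡m%n m n) ⟩
  (1 % n + m % n) % n         ≡⟨ %-distribˡ-+ 1 m n ⟨
  suc m % n                   ∎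
  where open ≡-Reasoning

toℕ-shift : .{{_ : NonZero n}} (r : Fin n) → toℕ (shift r) ≡ suc (toℕ r) % n
toℕ-shift {suc n} r = Fin.toℕ-fromℕ< _

toℕ-fold-shift : .{{_ : NonZero n}} (r : Fin n) (k : ℕ) →
                 toℕ (fold r shift k) ≡ (k + toℕ r) % n
toℕ-fold-shift r zero    = sym (m<n⇒m%n≡m (Fin.toℕ<n r))
toℕ-fold-shift {n} r (suc k) = begin
  toℕ (shift (fold r shift k))    ≡⟨ toℕ-shift (fold r shift k) ⟩
  suc (toℕ (fold r shift k)) % n  ≡⟨ cong (λ x → suc x % n) (toℕ-fold-shift r k) ⟩
  suc ((k + toℕ r) % n) % n       ≡⟨ suc-% (k + toℕ r) n ⟩
  suc (k + toℕ r) % n             ∎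
  where open ≡-Reasoning

fold-shift-cycle : (r : Fin n) → fold r shift n ≡ r
fold-shift-cycle {n@(suc _)} r = Fin.toℕ-injective (begin
  toℕ (fold r shift n)  ≡⟨ toℕ-fold-shift r n ⟩
  (n + toℕ r) % n       ≡⟨ cong (_% n) (+-comm n (toℕ r)) ⟩
  (toℕ r + n) % n       ≡⟨ [m+n]%n≡m%n (toℕ r) n ⟩
  toℕ r % n             ≡⟨ m<n⇒m%n≡m (Fin.toℕ<n r) ⟩
  toℕ r                 ∎)
  where open ≡-Reasoning

-- Division of `k + toℕ r` by `n` leaves the remainder `toℕ r`; cancelling it exhibits `k` as the
-- quotient times `n`.
fold-shift⇒∣ : (r : Fin n) (k : ℕ) → fold r shift k ≡ r → n ∣ k
fold-shift⇒∣ {n@(suc _)} r k eq = divides ((k + toℕ r) / n) (+-cancelʳ-≡ (toℕ r) k _ (begin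
  k + toℕ r                                ≡⟨ m≡m%n+[m/n]*n (k + toℕ r) n ⟩
  (k + toℕ r) % n + (k + toℕ r) / n * n    ≡⟨ cong (_+ (k + toℕ r) / n * n) (toℕ-fold-shift r k) ⟨
  toℕ (fold r shift k) + (k + toℕ r) / n * n ≡⟨ cong (λ x → toℕ x + (k + toℕ r) / n * n) eq ⟩
  toℕ r + (k + toℕ r) / n * n              ≡⟨ +-comm (toℕ r) _ ⟩
  (k + toℕ r) / n * n + toℕ r              ∎))
  where open ≡-Reasoning

-- Reduction modulo `n` works: as `n` divides `m`, reducing modulo `m` first does not change the
-- residue.
∣⇒shift-equivariant : .{{_ : NonZero n}} → n ∣ m → Equivariant (shift {m}) (shift {n})
∣⇒shift-equivariant {n} {zero}    n∣m = (λ ()) , λ ()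
∣⇒shift-equivariant {n} {m@(suc _)} n∣m = g , λ r → Fin.toℕ-injective (begin
  toℕ (g (shift r))          ≡⟨ toℕ-g (shift r) ⟩
  toℕ (shift r) % n          ≡⟨ cong (_% n) (toℕ-shift r) ⟩
  suc (toℕ r) % m % n        ≡⟨ m∣n⇒o%n%m≡o%m n m (suc (toℕ r)) n∣m ⟩
  suc (toℕ r) % n            ≡⟨ suc-% (toℕ r) n ⟨
  suc (toℕ r % n) % n        ≡⟨ cong (λ x → suc x % n) (toℕ-g r) ⟨
  suc (toℕ (g r)) % n        ≡⟨ toℕ-shift (g r) ⟨
  toℕ (shift (g r))          ∎)
  where
  open ≡-Reasoning
  g : Fin m → Fin n
  g r = toℕ r mod n
  toℕ-g : ∀ r → toℕ (g r) ≡ toℕ r % n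
  toℕ-g r = Fin.toℕ-fromℕ< _

Cycles : (Fin p → ℕ) → Set
Cycles c = ∃ λ i → Fin (c i)

rotate : (c : Fin p → ℕ) → Cycles c → Cycles c
rotate c (i , r) = i , shift r

fold-rotate : ∀ {c : Fin p → ℕ} i (r : Fin (c i)) k →
              fold (i , r) (rotate c) k ≡ (i , fold r shift k)
fold-rotate i r zero    = refl
fold-rotate {c = c} i r (suc k) = cong (rotate c) (fold-rotate i r k)

period∣ : ∀ {c : Fin p → ℕ} i (r : Fin (c i)) k →
          fold (i , r) (rotate c) k ≡ (i , r) → c i ∣ k
period∣ i r k eq = fold-shift⇒∣ r k
  (,-injectiveʳ (trans (sym (fold-rotate i r k)) eq))

Dominates : (Fin q → ℕ) → (Fin p → ℕ) → Set
Dominates d c = ∀ i → NonZero (c i) → ∃ λ j → NonZero (d j) × d j ∣ c i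

-- Walking once around a cycle of length `c i` returns to the start, so the image walk closes up too
-- and its period divides `c i`. Conversely, each cycle is wrapped around the one chosen for it.
rotate-equivariant : (c : Fin p → ℕ) (d : Fin q → ℕ) →
                     Equivariant (rotate c) (rotate d) ⇔ Dominates d c
rotate-equivariant c d = mk⇔ to from
  where
  to : Equivariant (rotate c) (rotate d) → Dominates d c
  to G@(g , _) i c≢0 = proj₁ (g x) , Fin.nonZeroIndex (proj₂ (g x)) , period∣ _ _ (c i) (begin
    fold (g x) (rotate d) (c i)     ≡⟨ fold-equivariant G x (c i) ⟨
    g (fold x (rotate c) (c i))     ≡⟨ cong g (fold-rotate i r (c i)) ⟩
    g (i , fold r shift (c i))      ≡⟨ cong (g ∘ (i ,_)) (fold-shift-cycle r) ⟩
    g x                             ∎)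
    where
    open ≡-Reasoning
    r : Fin (c i)
    r = fromℕ< (>-nonZero⁻¹ (c i) {{c≢0}})
    x : Cycles c
    x = i , r

  from : Dominates d c → Equivariant (rotate c) (rotate d)
  from dom = (λ (i , r) → target i r) , λ (i , r) → equivariant i r
    where
    -- The length is a variable here so that it can be matched as a successor, which settles
    -- `NonZero`. The choice of `j` depends on the cycle only, so a whole cycle lands in one cycle.
    component : ∀ n → (NonZero n → ∃ λ j → NonZero (d j) × d j ∣ n) → Fin n → Cycles d
    component n@(suc _) D r =
      let j , d≢0 , d∣n = D _ in j , proj₁ (∣⇒shift-equivariant {{d≢0}} d∣n) r

    component-shift : ∀ n D (r : Fin n) → component n D (shift r) ≡ rotate d (component n D r)
    component-shift n@(suc _) D r =
      let j , d≢0 , d∣n = D _ in cong (j ,_) (proj₂ (∣⇒shift-equivariant {{d≢0}} d∣n) r)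

    target : ∀ i → Fin (c i) → Cycles d
    target i = component (c i) (dom i)

    equivariant : ∀ i r → target i (shift r) ≡ rotate d (target i r)
    equivariant i = component-shift (c i) (dom i)

-- Representing a preorder on ℕ by cycle lengths

module Represent {ℓ} {_≼_ : Rel ℕ ℓ} (≼-refl : Reflexive _≼_) (≼-trans : Transitive _≼_)
                 (_≼?_ : Decidable _≼_) where

  factor : ℕ → ℕ → ℕ
  factor j i = if does (j ≼? i) then sylvester i else 1

  -- The number N j. The bound `suc j` lets the index `j` itself take part.
  cycleLength : ℕ → ℕ
  cycleLength j = ∏ (factor j) (suc j)

  cycleLength-nonZero : ∀ j → NonZero (cycleLength j)
  cycleLength-nonZero j = ∏-nonZero factor-nonZero (suc j)
    where
    factor-nonZero : ∀ i → NonZero (factor j i)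
    factor-nonZero i with j ≼? i
    ... | yes _ = _
    ... | no  _ = _

  sylvester∣cycleLength : ∀ j → sylvester j ∣ cycleLength j
  sylvester∣cycleLength j with j ≼? j
  ... | yes _   = n∣m*n (∏ (factor j) j)
  ... | no  j⋠j = contradiction ≼-refl j⋠j

  -- By transitivity every factor contributing to `cycleLength i` recurs in `cycleLength j`, whose
  -- index range is at least as long because `i ≤ j`.
  cycleLength-∣ : ∀ {i j} → j ≼ i → i ≤ j → cycleLength i ∣ cycleLength j
  cycleLength-∣ {i} {j} j≼i i≤j = ∏-mono-∣ (λ {l} _ → factor-∣ l) (≤⇒≤′ (s≤s i≤j))
    where
    factor-∣ : ∀ l → factor i l ∣ factor j l
    factor-∣ l with i ≼? l | j ≼? l
    ... | no  _   | _       = 1∣ _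
    ... | yes _   | yes _   = ∣-refl
    ... | yes i≼l | no  j⋠l = contradiction (≼-trans j≼i i≼l) j⋠l

  -- If `j ⋠ i`, then `sylvester i` is absent from the factors of `cycleLength j` and coprime to all
  -- of them, although it divides `cycleLength i`.
  cycleLength-∣⁻¹ : ∀ {i j} → cycleLength i ∣ cycleLength j → j ≼ i
  cycleLength-∣⁻¹ {i} {j} i∣j with j ≼? i
  ... | yes j≼i = j≼i
  ... | no  j⋠i = contradiction
    (coprime-∏ coprime-factor (suc j) (∣-trans (sylvester∣cycleLength i) i∣j))
    (sylvester∤1 i)
    where
    coprime-factor : ∀ l → Coprime (sylvester i) (factor j l)
    coprime-factor l with j ≼? l
    ... | yes j≼l = coprime-sylvester {i} {l} λ { refl → j⋠i j≼l }
    ... | no  _   = Coprime.sym (Coprime.1-coprimeTo _)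

  -- Components j ⋠ m are dropped by giving them length 0.
  lengths : ∀ m → Fin (suc m) → ℕ
  lengths m j = if does (toℕ j ≼? m) then cycleLength (toℕ j) else 0

  lengths-yes : ∀ {m} j → toℕ j ≼ m → lengths m j ≡ cycleLength (toℕ j)
  lengths-yes {m} j j≼m with toℕ j ≼? m
  ... | yes _   = refl
  ... | no  j⋠m = contradiction j≼m j⋠m

  lengths-nonZero : ∀ {m} j → NonZero (lengths m j) → toℕ j ≼ m
  lengths-nonZero {m} j l≢0 with toℕ j ≼? m
  ... | yes j≼m = j≼m

  Graph : ℕ → Set
  Graph m = Cycles (lengths m)

  step : ∀ m → Graph m → Graph m
  step m = rotate (lengths m)

  -- The cycle of a fixed vertex would have length 1, but that length is a multiple of
  -- `sylvester (toℕ j)`.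
  step-fixpointFree : ∀ m v → step m v ≢ v
  step-fixpointFree m (j , r) eq = sylvester∤1 (toℕ j) (∣-trans (sylvester∣cycleLength (toℕ j))
    (subst (_∣ 1) (lengths-yes j (lengths-nonZero j (Fin.nonZeroIndex r))) (period∣ j r 1 eq)))

  dominates : ∀ {m n} → Dominates (lengths n) (lengths m) ⇔ m ≼ n
  dominates {m} {n} = mk⇔ to from
    where
    to : Dominates (lengths n) (lengths m) → m ≼ n
    to dom =
      -- The cycle with the largest index `m` occurs by reflexivity. The cycle dominating it has an
      -- index below `n` in the preorder, and divisibility puts `m` below that index.
      let m′ = Fin.fromℕ m
          m′≡m = Fin.toℕ-fromℕ m
          m-eq = trans (lengths-yes m′ (subst (_≼ m) (sym m′≡m) ≼-refl)) (cong cycleLength m′≡m)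
          j , nz , j∣m = dom m′ (subst NonZero (sym m-eq) (cycleLength-nonZero m))
          j≼n = lengths-nonZero j nz
      in ≼-trans (cycleLength-∣⁻¹ (subst₂ _∣_ (lengths-yes j j≼n) m-eq j∣m)) j≼n

    from : m ≼ n → Dominates (lengths n) (lengths m)
    from m≼n i nz with lengths-nonZero i nz
    -- For `i ≤ n` the same cycle occurs in the target; otherwise the cycle of index `n` takes over,
    -- its length being a divisor since `i ≼ n` and `n ≤ i`.
    ... | i≼m = [ (λ i≤n → via (toℕ i) i≤n (≼-trans i≼m m≼n) ∣-refl)
                , (λ n≤i → via n ≤-refl ≼-refl (cycleLength-∣ (≼-trans i≼m m≼n) n≤i))
                ]′ (≤-total (toℕ i) n)
      where
      via : ∀ l → l ≤ n → l ≼ n → cycleLength l ∣ cycleLength (toℕ i) →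
            ∃ λ j → NonZero (lengths n j) × lengths n j ∣ lengths m i
      via l l≤n l≼n l∣i =
        j , subst NonZero (sym l-eq) (cycleLength-nonZero l)
          , subst₂ _∣_ (sym l-eq) (sym (lengths-yes i i≼m)) l∣i
        where
        j = fromℕ< (s≤s l≤n)
        j≡l : toℕ j ≡ l
        j≡l = Fin.toℕ-fromℕ< (s≤s l≤n)
        l-eq : lengths n j ≡ cycleLength l
        l-eq = trans (lengths-yes j (subst (_≼ n) (sym j≡l) l≼n)) (cong cycleLength j≡l)

  step-equivariant : ∀ {m n} → Equivariant (step m) (step n) ⇔ m ≼ n
  step-equivariant {m} {n} = mk⇔ (D.to ∘ R.to) (R.from ∘ D.from)
    where
    module D = Equivalence dominates
    module R = Equivalence (rotate-equivariant (lengths m) (lengths n))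

-- Labelled posets of self-maps

HasSize : Set → Set
HasSize A = ∃ λ n → A ↔ Fin n

Σ-hasSize : (c : Fin p → ℕ) → HasSize (Cycles c)
Σ-hasSize {zero}  c = 0 , mk↔ₛ′ (λ ()) (λ ()) (λ ()) (λ ())
Σ-hasSize {suc p} c =
  let n , rest = Σ-hasSize (c ∘ suc)
  in c zero + n , (↔-sym Fin.+↔⊎ ↔-∘ ((↔-id _ ⊎-↔ rest) ↔-∘ split))
  where
  split : Cycles c ↔ (Fin (c zero) ⊎ Cycles (c ∘ suc))
  split = mk↔ₛ′
    (λ { (zero , r) → inj₁ r ; (suc i , r) → inj₂ (i , r) })
    [ (zero ,_) , (λ (i , r) → suc i , r) ]′
    (λ { (inj₁ _) → refl ; (inj₂ _) → refl })
    (λ { (zero , _) → refl ; (suc _ , _) → refl })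

±-hasSize : HasSize A → HasSize (A ±)
±-hasSize (n , A↔Fin) = suc (suc n) , (Maybe↔Fin (Maybe↔Fin A↔Fin))
  where
  Maybe↔Fin : ∀ {B : Set} {n} → B ↔ Fin n → Maybe B ↔ Fin (suc n)
  Maybe↔Fin i = mk↔ₛ′
    (λ { (just x) → suc (to x) ; nothing → zero })
    (λ { zero → nothing ; (suc j) → just (from j) })
    (λ { zero → refl ; (suc j) → cong suc (strictlyInverseˡ j) })
    (λ { (just x) → cong just (strictlyInverseʳ x) ; nothing → refl })
    where open Inverse i

kposet : {_≤_ : Rel A 0ℓ} → IsPartialOrder _≡_ _≤_ → HasSize A → (A → Fin k) → FiniteKPoset k
kposet ≤-isPartialOrder (n , i) label = record
  { poset    = record { isPartialOrder = ≤-isPartialOrder }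
  ; finite   = n , record
      { to        = Inverse.to i
      ; from      = Inverse.from i
      ; to-cong   = Inverse.to-cong i
      ; from-cong = Inverse.from-cong i
      ; inverse   = Inverse.inverse i
      }
  ; labeling = record { to = label ; cong = cong label }
  }

xor-cancelˡ : ∀ b {x y} → b xor x ≡ b xor y → x ≡ y
xor-cancelˡ false eq = eq
xor-cancelˡ true  eq = not-injective eq

xor-cancelʳ : ∀ b {x y} → x xor b ≡ y xor b → x ≡ y
xor-cancelʳ b {x} {y} eq = xor-cancelˡ b (trans (xor-comm b x) (trans eq (xor-comm y b)))

-- The `Bool` picks one of the two chains of a vertex, the `Fin 3` a height in that chain.
Vertex Point : Set → Set
Vertex V = V × Bool
Point  V = Vertex V × Fin 3

level : Point V → Fin 3
level = proj₂

parity : Fin 3 → Bool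
parity 0F = false
parity 1F = true
parity 2F = false

-- Labels alternate along a chain: 0, 1, 0 or 1, 0, 1, depending on the `Bool`.
bit : Point V → Bool
bit ((_ , b) , l) = b xor parity l

-- Subdividing every arrow v → σ v makes consecutive vertices differ in their Bool
-- component, so that no homomorphism can collapse a link.
next : (V → V) → Vertex V → Vertex V
next σ (v , false) = v , true
next σ (v , true)  = σ v , false

next-flips : ∀ (σ : V → V) x → proj₂ (next σ x) ≢ proj₂ x
next-flips σ (v , false) ()
next-flips σ (v , true)  ()

next≢ : ∀ (σ : V → V) x → next σ x ≢ x
next≢ σ x eq = next-flips σ x (cong proj₂ eq)

-- Two steps of `next` keep the `Bool` and apply `σ` once.
next∘next≢ : ∀ {σ : V → V} → (∀ v → σ v ≢ v) → ∀ x → next σ (next σ x) ≢ x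
next∘next≢ σ≢ (v , false) eq = σ≢ v (cong proj₁ eq)
next∘next≢ σ≢ (v , true)  eq = σ≢ v (cong proj₁ eq)

-- A link runs from a bottom to a top, so two links never compose and the relation is transitive as
-- it stands. The equation in `link` keeps `next σ x` out of the indices, where it would block
-- pattern matching.
data Below (σ : V → V) : Rel (Point V) 0ℓ where
  stay : ∀ {x l l′} → l Fin.≤ l′ → Below σ (x , l) (x , l′)
  link : ∀ {x y} → y ≡ next σ x → Below σ (y , 0F) (x , 2F)

module _ {σ : V → V} where

  Below-trans : Transitive (Below σ)
  Below-trans (stay p) (stay q) = stay (≤-trans p q)
  Below-trans (stay {l = 0F} p) (link eq) = link eq
  Below-trans (link eq) (stay {l′ = 2F} q) = link eq
  Below-trans (link eq) (stay {l′ = 0F} ())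
  Below-trans (link eq) (stay {l′ = 1F} (s≤s ()))

  Below-antisym : ∀ {p q} → Below σ p q → Below σ q p → p ≡ q
  Below-antisym (stay p) (stay q) = cong (_ ,_) (Fin.≤-antisym p q)
  Below-antisym (stay ()) (link eq)
  Below-antisym (link eq) (stay ())

  Below-isPartialOrder : IsPartialOrder _≡_ (Below σ)
  Below-isPartialOrder = record
    { isPreorder = record
      { isEquivalence = isEquivalence
      ; reflexive     = λ { refl → stay ≤-refl }
      ; trans         = Below-trans
      }
    ; antisym = Below-antisym
    }

  -- Points of one chain at the same level have the same bit, and links rise anyway.
  level-< : ∀ {p q} → Below σ p q → bit p ≢ bit q → level p Fin.< level q
  level-< (stay {l = l} l≤l′) neq = Fin.≤∧≢⇒< l≤l′ λ { refl → neq refl }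
  level-< (link eq)           neq = s≤s z≤n

  -- Links join bottoms to tops only, so a middle point is comparable only within its chain.
  middle-above : ∀ {p q} → Below σ p q → level q ≡ 1F → proj₁ p ≡ proj₁ q
  middle-above (stay _) _ = refl

  middle-below : ∀ {p q} → Below σ p q → level p ≡ 1F → proj₁ p ≡ proj₁ q
  middle-below (stay _) _ = refl

  Below⁻¹ : ∀ {p q} → Below σ p q →
            proj₁ p ≡ proj₁ q ⊎ (proj₁ p ≡ next σ (proj₁ q) × level p ≡ 0F × level q ≡ 2F)
  Below⁻¹ (stay _)  = inj₁ refl
  Below⁻¹ (link eq) = inj₂ (eq , refl , refl)

<-chain : ∀ {i j l : Fin 3} → i Fin.< j → j Fin.< l → i ≡ 0F × j ≡ 1F × l ≡ 2F
<-chain {0F}    {1F} {2F} _ _ = refl , refl , refl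
<-chain {j = 0F} ()
<-chain {l = 0F} _ ()
<-chain {suc _} {1F} (s≤s ()) _
<-chain {j = 1F} {1F} _ (s≤s ())
<-chain {j = 2F} {1F} _ (s≤s ())
<-chain {j = 2F} {2F} _ (s≤s (s≤s ()))

-- Homomorphisms of point posets versus equivariant maps

PreservesBits : (Point V → Point W) → Set
PreservesBits f = ∀ p → bit (f p) ≡ bit p

Monotone : (V → V) → (W → W) → (Point V → Point W) → Set
Monotone σ τ f = ∀ {p q} → Below σ p q → Below τ (f p) (f q)

extend : (V → W) → Point V → Point W
extend g ((v , b) , l) = (g v , b) , l

module _ {σ : V → V} {τ : W → W} where

  module _ {f : Point V → Point W} (mono : Monotone σ τ f) (bits : PreservesBits f) where

    private
      -- The middle point decides which chain the image is, since no link touches a middle level.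
      vertex : Vertex V → Vertex W
      vertex x = proj₁ (f (x , 1F))

      low  : ∀ x → Below τ (f (x , 0F)) (f (x , 1F))
      low x = mono (stay z≤n)

      high : ∀ x → Below τ (f (x , 1F)) (f (x , 2F))
      high x = mono (stay (s≤s z≤n))

      bit-changes : ∀ x {l l′} → parity l ≢ parity l′ → bit (f (x , l)) ≢ bit (f (x , l′))
      bit-changes (v , b) {l} {l′} l≢l′ eq =
        l≢l′ (xor-cancelˡ b (trans (sym (bits _)) (trans eq (bits _))))

      -- Consecutive labels of a chain differ, so the levels of the images rise strictly twice, and
      -- `Fin 3` leaves only one possibility.
      levels : ∀ x → level (f (x , 0F)) ≡ 0F × level (f (x , 1F)) ≡ 1F × level (f (x , 2F)) ≡ 2F
      levels x = <-chain (level-< (low x) (bit-changes x λ ())) (level-< (high x) (bit-changes x λ ()))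

      f-0 : ∀ x → f (x , 0F) ≡ (vertex x , 0F)
      f-0 x = let l₀ , l₁ , _ = levels x in cong₂ _,_ (middle-above (low x) l₁) l₀

      f-2 : ∀ x → f (x , 2F) ≡ (vertex x , 2F)
      f-2 x = let _ , l₁ , l₂ = levels x in cong₂ _,_ (sym (middle-below (high x) l₁)) l₂

      vertex-bit : ∀ x → proj₂ (vertex x) ≡ proj₂ x
      vertex-bit x = xor-cancelʳ true (begin
        proj₂ (vertex x) xor true
          ≡⟨ cong (λ l → proj₂ (vertex x) xor parity l) (proj₁ (proj₂ (levels x))) ⟨
        bit (f (x , 1F))           ≡⟨ bits (x , 1F) ⟩
        proj₂ x xor true           ∎)
        where open ≡-Reasoning

      -- The image of a link goes from level 0 to level 2, either inside one chain or along a link.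
      -- The former would equate `Bool` components that `next` flips and `vertex` preserves.
      vertex-next : ∀ x → vertex (next σ x) ≡ next τ (vertex x)
      vertex-next x with Below⁻¹ (subst₂ (Below τ) (f-0 (next σ x)) (f-2 x) (mono (link refl)))
      ... | inj₁ eq       = contradiction
        (trans (sym (vertex-bit (next σ x))) (trans (cong proj₂ eq) (vertex-bit x)))
        (next-flips σ x)
      ... | inj₂ (eq , _) = eq

      vertex-pair : ∀ v b → vertex (v , b) ≡ (proj₁ (vertex (v , b)) , b)
      vertex-pair v b = cong (proj₁ (vertex (v , b)) ,_) (vertex-bit (v , b))

    restrict : Equivariant σ τ
    -- One step of `σ` is two steps of `next`; the chains with `Bool` component `false` stand for
    -- the original vertices.
    restrict = (λ v → proj₁ (vertex (v , false))) , λ v → cong proj₁ (begin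
      vertex (σ v , false)                           ≡⟨ vertex-next (v , true) ⟩
      next τ (vertex (v , true))                     ≡⟨ cong (next τ) (vertex-next (v , false)) ⟩
      next τ (next τ (vertex (v , false)))           ≡⟨ cong (next τ ∘ next τ) (vertex-pair v false) ⟩
      (τ (proj₁ (vertex (v , false))) , false)       ∎)
      where open ≡-Reasoning

  extend-mono : ((g , _) : Equivariant σ τ) → Monotone σ τ (extend g)
  extend-mono _         (stay l≤l′)                 = stay l≤l′
  extend-mono _         (link {x = v , false} refl) = link refl
  extend-mono (_ , g-σ) (link {x = v , true}  refl) = link (cong (_, false) (g-σ v))

-- Lattices

-- The shape agrees with the lattice fields `supremum` and `infimum`; through `flip`, `lub-swap`
-- serves meets as well.
IsLub IsGlb : Rel A 0ℓ → A → A → A → Set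
IsLub _⊑_ x y z = x ⊑ z × y ⊑ z × (∀ w → x ⊑ w → y ⊑ w → z ⊑ w)
IsGlb _⊑_ = IsLub (flip _⊑_)

[]≰⊥± : {_⊑_ : Rel A 0ℓ} {x : A} → ¬ Extrema._≤±_ _⊑_ [ x ] ⊥±
[]≰⊥± Supremum.[ () ]

module _ (em : ExcludedMiddle 0ℓ) {_⊑_ : Rel A 0ℓ} (⊑-isPartialOrder : IsPartialOrder _≡_ _⊑_)
         (lub : ∀ {x y u} → x ⊑ u → y ⊑ u → ∃ (IsLub _⊑_ x y))
         (glb : ∀ {x y d} → d ⊑ x → d ⊑ y → ∃ (IsGlb _⊑_ x y)) where

  open Extrema _⊑_ renaming ([_] to ⟨_⟩)

  private
    module ⊑ = IsPartialOrder ⊑-isPartialOrder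
    module ± = IsPartialOrder (≤±-isPartialOrder-≡ ⊑-isPartialOrder)

    lub± : ∀ x y → ∃ (IsLub _≤±_ x y)
    lub± ⊥±    y     = y , ⊥±≤ y , ±.refl , λ _ _ y≤w → y≤w
    lub± x     ⊥±    = x , ±.refl , ⊥±≤ x , λ _ x≤w _ → x≤w
    lub± ⊤±    y     = ⊤± , ±.refl , y ≤⊤± , λ _ x≤w _ → x≤w
    lub± x     ⊤±    = ⊤± , x ≤⊤± , ±.refl , λ _ _ y≤w → y≤w
    -- Excluded middle decides whether the pair was bounded before the extrema were added.
    lub± [ x ] [ y ] with em {∃ λ u → x ⊑ u × y ⊑ u}
    ... | yes (_ , x⊑u , y⊑u) = let z , x⊑z , y⊑z , least = lub x⊑u y⊑u in
      [ z ] , ⟨ x⊑z ⟩ , ⟨ y⊑z ⟩ , λ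
        { [ w ] x≤w y≤w → ⟨ least w ([≤]-injective x≤w) ([≤]-injective y≤w) ⟩
        ; ⊤±    _   _   → [ z ] ≤⊤±
        ; ⊥±    x≤⊥ _   → contradiction x≤⊥ []≰⊥±
        }
    ... | no unbounded = ⊤± , [ x ] ≤⊤± , [ y ] ≤⊤± , λ
        { [ w ] x≤w y≤w → contradiction (w , [≤]-injective x≤w , [≤]-injective y≤w) unbounded
        ; ⊤±    _   _   → ±.refl
        ; ⊥±    x≤⊥ _   → contradiction x≤⊥ []≰⊥±
        }

    glb± : ∀ x y → ∃ (IsGlb _≤±_ x y)
    glb± ⊥±    y     = ⊥± , ±.refl , (⊥±≤ y) , λ _ w≤x _ → w≤x
    glb± x     ⊥±    = ⊥± , (⊥±≤ x) , ±.refl , λ _ _ w≤y → w≤y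
    glb± ⊤±    y     = y , y ≤⊤± , ±.refl , λ _ _ w≤y → w≤y
    glb± x     ⊤±    = x , ±.refl , x ≤⊤± , λ _ w≤x _ → w≤x
    glb± [ x ] [ y ] with em {∃ λ d → d ⊑ x × d ⊑ y}
    ... | yes (_ , d⊑x , d⊑y) = let z , z⊑x , z⊑y , greatest = glb d⊑x d⊑y in
      [ z ] , ⟨ z⊑x ⟩ , ⟨ z⊑y ⟩ , λ
        { [ w ] w≤x w≤y → ⟨ greatest w ([≤]-injective w≤x) ([≤]-injective w≤y) ⟩
        ; ⊥±    _   _   → ⊥±≤ [ z ]
        ; ⊤±    ()  _
        }
    ... | no unbounded = ⊥± , (⊥±≤ [ x ]) , (⊥±≤ [ y ]) , λ
        { [ w ] w≤x w≤y → contradiction (w , [≤]-injective w≤x , [≤]-injective w≤y) unbounded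
        ; ⊥±    _   _   → ±.refl
        ; ⊤±    ()  _
        }

  -- A pair without upper bound acquires the join `⊤±`, one without lower bound the meet `⊥±`; hence
  -- the hypotheses only concern bounded pairs.
  ±-isLattice : ∃₂ (IsLattice _≡_ _≤±_)
  ±-isLattice = (λ x y → proj₁ (lub± x y)) , (λ x y → proj₁ (glb± x y)) , record
    { isPartialOrder = ≤±-isPartialOrder-≡ ⊑-isPartialOrder
    ; supremum       = λ x y → proj₂ (lub± x y)
    ; infimum        = λ x y → proj₂ (glb± x y)
    }

module _ {σ : V → V} where

  Below⇒lub : ∀ {p q} → Below σ p q → IsLub (Below σ) p q q
  Below⇒lub p⊑q = p⊑q , stay ≤-refl , λ _ _ q⊑w → q⊑w

  Below⇒glb : ∀ {p q} → Below σ p q → IsGlb (Below σ) p q p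
  Below⇒glb p⊑q = stay ≤-refl , p⊑q , λ _ w⊑p _ → w⊑p

  lub-swap : ∀ {_⊑_ : Rel (Point V) 0ℓ} {p q} → ∃ (IsLub _⊑_ p q) → ∃ (IsLub _⊑_ q p)
  lub-swap (z , p⊑z , q⊑z , least) = z , q⊑z , p⊑z , λ w q⊑w p⊑w → least w p⊑w q⊑w

  module _ (σ≢ : ∀ v → σ v ≢ v) where

    -- An upper bound `w` sits above two successive chains. Belonging to both, or being linked from
    -- both, would give `next σ x ≡ x`; belonging to the second alone would give a 2-cycle of
    -- `next σ`. This leaves the top of the first.
    lub-link : ∀ {x y l} → y ≡ next σ x → IsLub (Below σ) (x , l) (y , 0F) (x , 2F)
    lub-link {x} {l = l} refl = stay (Fin.≤fromℕ l) , link refl , least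
      where
      least : ∀ w → Below σ (x , l) w → Below σ (next σ x , 0F) w → Below σ (x , 2F) w
      least w h₁ h₂ with Below⁻¹ h₁ | Below⁻¹ h₂
      ... | inj₁ x≡w       | inj₁ nx≡w      = contradiction (trans nx≡w (sym x≡w)) (next≢ σ x)
      ... | inj₁ refl      | inj₂ (_ , _ , refl) = stay ≤-refl
      ... | inj₂ (x≡nw , _) | inj₁ refl      = contradiction (sym x≡nw) (next∘next≢ σ≢ x)
      ... | inj₂ (x≡nw , _) | inj₂ (nx≡nw , _) = contradiction (trans nx≡nw (sym x≡nw)) (next≢ σ x)

    lub : ∀ {p q u} → Below σ p u → Below σ q u → ∃ (IsLub (Below σ) p q)
    lub (stay {l = l} _) (stay {l = l′} _) with ≤-total (toℕ l) (toℕ l′)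
    ... | inj₁ l≤l′ = _ , Below⇒lub (stay l≤l′)
    ... | inj₂ l′≤l = lub-swap (_ , Below⇒lub (stay l′≤l))
    lub (stay _)    (link eq)   = _ , lub-link eq
    lub (link eq)   (stay _)    = lub-swap (_ , lub-link eq)
    -- Both points are the bottom of the chain following that of the bound, so they coincide.
    lub (link refl) (link refl) = _ , Below⇒lub (stay ≤-refl)

    glb-link : ∀ {x y l} → y ≡ next σ x → IsGlb (Below σ) (y , l) (x , 2F) (y , 0F)
    glb-link {x} {l = l} refl = stay z≤n , link refl , greatest
      where
      greatest : ∀ w → Below σ w (next σ x , l) → Below σ w (x , 2F) → Below σ w (next σ x , 0F)
      greatest w h₁ h₂ with Below⁻¹ h₁ | Below⁻¹ h₂
      ... | inj₁ w≡nx        | inj₁ w≡x        = contradiction (trans (sym w≡nx) w≡x) (next≢ σ x)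
      ... | inj₁ refl        | inj₂ (_ , refl , _) = stay ≤-refl
      ... | inj₂ (w≡nnx , _) | inj₁ w≡x        = contradiction (trans (sym w≡nnx) w≡x) (next∘next≢ σ≢ x)
      ... | inj₂ (w≡nnx , _) | inj₂ (w≡nx , _) =
        contradiction (trans (sym w≡nnx) w≡nx) (next≢ σ (next σ x))

    -- `next σ` may fail to be injective, so distinct tops can be linked to one bottom. Joins have
    -- no such case, as a top is linked to a single bottom.
    glb-links : ∀ {x y z} → x ≢ y → z ≡ next σ x → z ≡ next σ y →
                IsGlb (Below σ) (x , 2F) (y , 2F) (z , 0F)
    glb-links {x} {y} {z} x≢y z≡nx z≡ny = link z≡nx , link z≡ny , greatest
      where
      greatest : ∀ w → Below σ w (x , 2F) → Below σ w (y , 2F) → Below σ w (z , 0F)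
      greatest w h₁ h₂ with Below⁻¹ h₁ | Below⁻¹ h₂
      ... | inj₁ w≡x         | inj₁ w≡y        = contradiction (trans (sym w≡x) w≡y) x≢y
      ... | inj₁ refl        | inj₂ (w≡ny , _) =
        contradiction (trans (sym z≡nx) (trans z≡ny (sym w≡ny))) (next≢ σ x)
      ... | inj₂ (w≡nx , _)  | inj₁ refl       =
        contradiction (trans (sym z≡ny) (trans z≡nx (sym w≡nx))) (next≢ σ y)
      ... | inj₂ (w≡nx , refl , _) | inj₂ _ with refl ← trans w≡nx (sym z≡nx) = stay ≤-refl

    glb : ExcludedMiddle 0ℓ → ∀ {p q d} → Below σ d p → Below σ d q → ∃ (IsGlb (Below σ) p q)
    glb em (stay {l′ = l} _) (stay {l′ = l′} _) with ≤-total (toℕ l) (toℕ l′)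
    ... | inj₁ l≤l′ = _ , Below⇒glb (stay l≤l′)
    ... | inj₂ l′≤l = lub-swap (_ , Below⇒glb (stay l′≤l))
    glb em (stay _)    (link eq)   = _ , glb-link eq
    glb em (link eq)   (stay _)    = lub-swap (_ , glb-link eq)
    -- Equal tops are their own meet, whereas distinct ones meet in the bottom they share.
    glb em (link {x = x} eq) (link {x = y} eq′) with em {x ≡ y}
    ... | yes refl = _ , Below⇒glb (stay ≤-refl)
    ... | no  x≢y  = _ , glb-links x≢y eq eq′

-- Representing self-maps in 𝒫̃ k and ℒ̃ k

record SelfMap : Set₁ where
  field
    Carrier       : Set
    map           : Carrier → Carrier
    hasSize       : HasSize Carrier
    fixpointFree  : ∀ v → map v ≢ v

-- The interface shared by posets and lattices: the homomorphism quasiorder of finite self-maps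
-- without fixed points sits inside `U`.
Represents : Poset b ℓ₁ ℓ₂ → Set _
Represents U = Σ (SelfMap → Poset.Carrier U) λ F → ∀ {S T} →
  Poset._≤_ U (F S) (F T) ⇔ Equivariant (SelfMap.map S) (SelfMap.map T)

Point-hasSize : HasSize V → HasSize (Point V)
Point-hasSize (n , V↔Fin) =
  (n * 2) * 3 , (↔-sym Fin.*↔× ↔-∘ ((↔-sym Fin.*↔× ↔-∘ (V↔Fin ×-↔ ↔-sym Fin.2↔Bool)) ×-↔ ↔-id _))

module _ {colour : Bool → Fin k} (colour-injective : Injective _≡_ _≡_ colour) where

  pointPoset : SelfMap → FiniteKPoset k
  pointPoset S = kposet (Below-isPartialOrder {σ = map}) (Point-hasSize hasSize) (colour ∘ bit)
    where open SelfMap S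

  𝒫̃-represents : Represents (𝒫̃ k)
  𝒫̃-represents = pointPoset , λ {S} {T} → mk⇔
    (λ h → restrict (Hom.homomorphism h .PosetHomomorphism.mono)
      (colour-injective ∘ Hom.preserves-label h))
    (λ G@(g , _) → record
      { homomorphism = record
        { ⟦_⟧ = extend g
        ; isOrderHomomorphism = record { cong = cong (extend g) ; mono = extend-mono G }
        }
      ; preserves-label = λ _ → refl
      })

  module _ (em : ExcludedMiddle 0ℓ) {c : Fin k} (colour≢c : ∀ b → colour b ≢ c) where

    private
      label± : Point V ± → Fin k
      label± ⊥±    = c
      label± [ p ] = colour (bit p)
      label± ⊤±    = c

    pointLattice : SelfMap → FiniteKLattice k
    pointLattice S =
        kposet (Extrema.≤±-isPartialOrder-≡ _ Below-isPartialOrder)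
          (±-hasSize (Point-hasSize hasSize)) label±
      , ±-isLattice em (Below-isPartialOrder {σ = map}) (lub fixpointFree) (glb fixpointFree em)
      where open SelfMap S

    -- The label `c` occurs at the extrema only, so a homomorphism sends points to points and
    -- restricts to the point posets.
    ℒ̃-represents : Represents (ℒ̃ k)
    ℒ̃-represents = pointLattice , λ {S} {T} → mk⇔ (to {S} {T}) (from {S} {T})
      where
      module _ {S T : SelfMap} where
        private
          module S = SelfMap S
          module T = SelfMap T
          module S± = Extrema (Below S.map)
          module T± = Extrema (Below T.map)

        to : LatticeHom (pointLattice S) (pointLattice T) → Equivariant S.map T.map
        to h = restrict {σ = S.map} {T.map} {f} mono bits
          where
          unbracket : ∀ q → label± q ≢ c → ∃ λ p → q ≡ [ p ]
          unbracket ⊥±    ≢c = contradiction refl ≢c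
          unbracket [ p ] ≢c = p , refl
          unbracket ⊤±    ≢c = contradiction refl ≢c

          h-[_] : ∀ p → ∃ λ q → Hom.⟦ h ⟧ [ p ] ≡ [ q ]
          h-[ p ] = unbracket _ (λ eq → colour≢c (bit p) (trans (sym (Hom.preserves-label h [ p ])) eq))

          f : Point S.Carrier → Point T.Carrier
          f p = proj₁ h-[ p ]

          mono : Monotone S.map T.map f
          mono {p} {q} p⊑q = T±.[≤]-injective (subst₂ T±._≤±_
            (proj₂ h-[ p ]) (proj₂ h-[ q ])
            (Hom.homomorphism h .PosetHomomorphism.mono S±.[ p⊑q ]))

          bits : PreservesBits f
          bits p = colour-injective
            (trans (sym (cong label± (proj₂ h-[ p ]))) (Hom.preserves-label h [ p ]))

        from : Equivariant S.map T.map → LatticeHom (pointLattice S) (pointLattice T)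
        from G@(g , _) = record
          { homomorphism = record
            { ⟦_⟧ = extend±
            ; isOrderHomomorphism = record { cong = cong extend± ; mono = mono }
            }
          ; preserves-label = λ { ⊥± → refl ; [ _ ] → refl ; ⊤± → refl }
          }
          where
          extend± : Point S.Carrier ± → Point T.Carrier ±
          extend± ⊥±    = ⊥±
          extend± [ p ] = [ extend g p ]
          extend± ⊤±    = ⊤±

          mono : ∀ {p q} → p S±.≤± q → extend± p T±.≤± extend± q
          mono {⊥±}    {q}     _   = T±.⊥±≤ extend± q
          mono {p}     {⊤±}    _   = extend± p T±.≤⊤±
          mono {[ p ]} {⊥±}    p≤⊥ = contradiction p≤⊥ []≰⊥±
          mono {[ p ]} {[ q ]} p≤q = T±.[ extend-mono G (S±.[≤]-injective p≤q) ]

-- Universality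

Represents⇒Embeds : (U : Poset b ℓ₁ ℓ₂) → Represents U → Classical →
                    ∀ {a ℓ₃ ℓ₄} (Q : Poset a ℓ₃ ℓ₄) → Countable Q → Embeds Q U
Represents⇒Embeds U (F , F-≤) classical {a} {_} {ℓ₄} Q countable =
  F ∘ graph ∘ to , record
    { isOrderHomomorphism = record
      { cong = λ x≈y → U.antisym (mono (Q.reflexive x≈y)) (mono (Q.reflexive (Q.Eq.sym x≈y)))
      ; mono = mono
      }
    ; injective = λ Fx≈Fy → Q.antisym
        (cancel (U.reflexive Fx≈Fy)) (cancel (U.reflexive (U.Eq.sym Fx≈Fy)))
    ; cancel    = cancel
    }
  where
  module Q = Poset Q
  module U = Poset U
  open Injection countable using (to; injective)

  -- The order of `Q` carried over to codes; the disjunct `m ≡ n` gives reflexivity at numbers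
  -- outside the image of `to`.
  _≼_ : Rel ℕ (a ⊔ ℓ₄)
  m ≼ n = m ≡ n ⊎ ∃₂ λ x y → to x ≡ m × to y ≡ n × x Q.≤ y

  ≼⇒≤ : ∀ {x y} → to x ≼ to y → x Q.≤ y
  ≼⇒≤ (inj₁ eq) = Q.reflexive (injective eq)
  ≼⇒≤ (inj₂ (_ , _ , x≡ , y≡ , x≤y)) =
    Q.trans (Q.reflexive (injective (sym x≡))) (Q.trans x≤y (Q.reflexive (injective y≡)))

  ≼-trans : Transitive _≼_
  ≼-trans (inj₁ refl) j≼k         = j≼k
  ≼-trans (inj₂ i≼j)  (inj₁ refl) = inj₂ i≼j
  ≼-trans (inj₂ (x , _ , x≡ , refl , x≤y)) y≼z@(inj₂ (_ , z , _ , refl , _)) =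
    inj₂ (x , z , x≡ , refl , Q.trans x≤y (≼⇒≤ y≼z))

  open Represent {_≼_ = _≼_} (inj₁ refl) ≼-trans (λ _ _ → classical)

  graph : ℕ → SelfMap
  graph m = record
    { map          = step m
    ; hasSize      = Σ-hasSize (lengths m)
    ; fixpointFree = step-fixpointFree m
    }

  mono : ∀ {x y} → x Q.≤ y → F (graph (to x)) U.≤ F (graph (to y))
  mono x≤y = Equivalence.from F-≤ (Equivalence.from step-equivariant (inj₂ (_ , _ , refl , refl , x≤y)))

  cancel : ∀ {x y} → F (graph (to x)) U.≤ F (graph (to y)) → x Q.≤ y
  cancel = ≼⇒≤ ∘ Equivalence.to step-equivariant ∘ Equivalence.to F-≤

-- Countability

least : ExcludedMiddle ℓ → {P : ℕ → Set ℓ} → ∃ P → ∃ λ n → P n × (∀ m → P m → n ≤ m)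
least em {P} (n , Pn) = <-rec (λ n → P n → ∃ λ n → P n × (∀ m → P m → n ≤ m)) search n Pn
  where
  search : ∀ n → (∀ {m} → m < n → P m → _) → P n → _
  search n rec Pn with em {∃ λ m → m < n × P m}
  ... | yes (_ , m<n , Pm) = rec m<n Pm
  ... | no  minimal = n , Pn , λ m Pm → ≮⇒≥ λ m<n → minimal (m , m<n , Pm)

-- The code need not respect _≈_: send x to the least code of its class.
module _ (em : ExcludedMiddle (a ⊔ ℓ)) (S : Setoid a ℓ) where

  private module S = Setoid S

  code⇒countable : (code : S.Carrier → ℕ) → (∀ {x y} → code x ≡ code y → x S.≈ y) →
                   Injection S (setoid ℕ)
  code⇒countable code code⇒≈ = record
    { to        = canonical
    ; cong      = λ x≈y → ≤-antisym (canonical-mono x≈y) (canonical-mono (S.sym x≈y))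
    ; injective = λ {x} {y} eq →
        let x′ , x′-code , x≈x′ = proj₁ (proj₂ (leastCode x))
            y′ , y′-code , y≈y′ = proj₁ (proj₂ (leastCode y))
        in S.trans x≈x′ (S.trans (code⇒≈ (trans x′-code (trans eq (sym y′-code)))) (S.sym y≈y′))
    }
    where
    HasCode : S.Carrier → ℕ → Set (a ⊔ ℓ)
    HasCode x n = ∃ λ y → code y ≡ n × x S.≈ y
    leastCode : ∀ x → ∃ λ n → HasCode x n × (∀ m → HasCode x m → n ≤ m)
    leastCode x = least em (code x , x , refl , S.refl)
    canonical : S.Carrier → ℕ
    canonical x = proj₁ (leastCode x)
    canonical-mono : ∀ {x y} → x S.≈ y → canonical x ≤ canonical y
    canonical-mono {x} {y} x≈y =
      let z , z-code , y≈z = proj₁ (proj₂ (leastCode y))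
      in proj₂ (proj₂ (leastCode x)) _ (z , z-code , S.trans x≈y y≈z)

-- This is 2^m (2n + 1) - 1; the parity of a value tells which clause produced it.
pair : ℕ → ℕ → ℕ
pair zero    n = 2 * n
pair (suc m) n = suc (2 * pair m n)

pair-injective : ∀ m m′ {n n′} → pair m n ≡ pair m′ n′ → m ≡ m′ × n ≡ n′
pair-injective zero    zero    eq = refl , *-cancelˡ-≡ _ _ 2 eq
pair-injective zero    (suc m′) {n} {n′} eq = contradiction eq (even≢odd n (pair m′ n′))
pair-injective (suc m) zero {n} {n′} eq = contradiction (sym eq) (even≢odd n′ (pair m n))
pair-injective (suc m) (suc m′) eq =
  let m≡m′ , n≡n′ = pair-injective m m′ (*-cancelˡ-≡ _ _ 2 (suc-injective eq))
  in cong suc m≡m′ , n≡n′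

funToFin-injective : {f g : Fin m → Fin n} → funToFin f ≡ funToFin g → ∀ i → f i ≡ g i
funToFin-injective {f = f} {g} eq i = begin
  f i                       ≡⟨ Fin.finToFun-funToFin f i ⟨
  finToFun (funToFin f) i   ≡⟨ cong (λ x → finToFun x i) eq ⟩
  finToFun (funToFin g) i   ≡⟨ Fin.finToFun-funToFin g i ⟩
  g i                       ∎
  where open ≡-Reasoning

truth : ∀ {P : Set ℓ} → Dec P → Fin 2
truth (no  _) = 0F
truth (yes _) = 1F

truth-injective : ∀ {P : Set ℓ₁} {Q : Set ℓ₂} (p : Dec P) (q : Dec Q) → truth p ≡ truth q → P → Q
truth-injective (yes _) (yes q) _ _ = q
truth-injective (no ¬p) _       _ p = contradiction p ¬p

module _ (em : ExcludedMiddle 0ℓ) where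

  private
    module K {k} = FiniteKPoset {k}

    order : (P : FiniteKPoset k) → (Fin n → K.Carrier P) → Fin n → Fin n → Fin 2
    order P from i j = truth (em {K._≤_ P (from i) (from j)})

    -- The finiteness witness is a separate argument so that the sizes of two posets can be
    -- identified by matching.
    codeOf : (P : FiniteKPoset k) → Finite (K.poset P) → ℕ
    codeOf P (n , e) = pair n (pair
      (toℕ (funToFin (funToFin ∘ order P from))) (toℕ (funToFin (K.label P ∘ from))))
      where open Inverse e

    -- Equal codes mean equal sizes, order matrices and label sequences, so sending each element to
    -- the one with the same index is a homomorphism.
    codeOf⇒Hom : (P Q : FiniteKPoset k) (s : Finite (K.poset P)) (t : Finite (K.poset Q)) →
                 codeOf P s ≡ codeOf Q t → Hom P Q
    codeOf⇒Hom P Q (n , e) (m , e′) eq with pair-injective n m eq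
    ... | refl , eq′ = record
      { homomorphism = record
        { ⟦_⟧ = E′.from ∘ E.to
        ; isOrderHomomorphism = record
          { cong = E′.from-cong ∘ E.to-cong
          ; mono = λ {x} {y} x≤y → truth-injective em em (same-order (E.to x) (E.to y))
              (P.trans (P.reflexive (E.strictlyInverseʳ x))
                (P.trans x≤y (P.reflexive (P.Eq.sym (E.strictlyInverseʳ y)))))
          }
        }
      ; preserves-label = λ x → trans (sym (same-label (E.to x)))
          (Func.cong (K.labeling P) (E.strictlyInverseʳ x))
      }
      where
      module E  = Inverse e
      module E′ = Inverse e′
      module P  = Poset (K.poset P)
      codes = pair-injective (toℕ (funToFin (funToFin ∘ order P E.from))) _ eq′
      same-order : ∀ i j → order P E.from i j ≡ order Q E′.from i j
      same-order i = funToFin-injective (funToFin-injective (Fin.toℕ-injective (proj₁ codes)) i)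
      same-label : ∀ i → K.label P (E.from i) ≡ K.label Q (E′.from i)
      same-label = funToFin-injective (Fin.toℕ-injective (proj₂ codes))

  posetCode : FiniteKPoset k → ℕ
  posetCode P = codeOf P (K.finite P)

  posetCode⇒Hom : (P Q : FiniteKPoset k) → posetCode P ≡ posetCode Q → Hom P Q
  posetCode⇒Hom P Q = codeOf⇒Hom P Q (K.finite P) (K.finite Q)

-- Equality in the quotient is a pair of opposite homomorphisms; the equation of codes, read both
-- ways, supplies them.
𝒫̃-countable : Classical → ∀ k → Countable (𝒫̃ k)
𝒫̃-countable classical k = code⇒countable classical (Poset.Eq.setoid (𝒫̃ k)) (posetCode classical)
  λ {P} {Q} eq → posetCode⇒Hom classical P Q eq , posetCode⇒Hom classical Q P (sym eq)

ℒ̃-countable : Classical → ∀ k → Countable (ℒ̃ k)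
ℒ̃-countable classical k = code⇒countable classical (Poset.Eq.setoid (ℒ̃ k)) (posetCode classical ∘ proj₁)
  λ {L} {M} eq → posetCode⇒Hom classical (proj₁ L) (proj₁ M) eq
               , posetCode⇒Hom classical (proj₁ M) (proj₁ L) (sym eq)

-- Choice of labels and conclusion

bool : Bool → Fin 2
bool = Inverse.from Fin.2↔Bool

bool-injective : Injective _≡_ _≡_ bool
bool-injective {false} {false} _ = refl
bool-injective {true}  {true}  _ = refl

theorem3p5 : ∀ {a ℓ₁ ℓ₂} → Classical →
    (∀ k → 2 ≤ k → Universal a ℓ₁ ℓ₂ (𝒫̃ k)) ×
    (∀ k → 3 ≤ k → Universal a ℓ₁ ℓ₂ (ℒ̃ k))
theorem3p5 classical =
    (λ k 2≤k → 𝒫̃-countable classical k , Represents⇒Embeds (𝒫̃ k)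
      (𝒫̃-represents (bool-injective ∘ Fin.inject≤-injective 2≤k 2≤k _ _))
      classical)
  , (λ k 3≤k → ℒ̃-countable classical k , Represents⇒Embeds (ℒ̃ k)
      -- Label 0 is reserved for the extrema, so the bits take labels 1 and 2.
      (ℒ̃-represents {colour = λ b → inject≤ (suc (bool b)) 3≤k}
        (bool-injective ∘ Fin.suc-injective ∘ Fin.inject≤-injective 3≤k 3≤k _ _)
        classical {c = inject≤ zero 3≤k}
        (λ b eq → contradiction (Fin.inject≤-injective 3≤k 3≤k _ _ eq) λ ()))
      classical)
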